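{- For every $t\in\mathbb N$, $R_<(\text{Alt- }P_t)\le 3t+3$.
   Context: An ordered graph on $n$ vertices has vertex set $[n]$ with its natural order; an ordered graph $G$ contains a copy of an ordered graph $H$ if there is an injective, order-preserving map $V(H)\to V(G)$ sending edges to edges. $R_<(H)$ is the smallest $N$ such that every red/blue colouring of the edges of the complete ordered graph on $[N]$ contains a monochromatic copy of $H$. The alternating path $\text{Alt- }P_t$ is the ordered path on vertex set $[t]$ whose vertex sequence is $t,1,t-1,2,t-2,3,\dots$ (e.g. for $t=6$ its edges are $16,15,25,24,34$); equivalently, an ordered path on $t$ vertices whose edges' spanned intervals are pairwise nested (one containing the other). -}

module Defs where

open import Data.Nat using (ℕ; zero; suc; _+_; _*_; _∸_; _<_; _≤_)
open import Data.Nat.DivMod using (_/_; _%_)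
open import Data.Bool using (Bool)
open import Data.Product using (Σ; _×_; ∃)
open import Relation.Binary.PropositionalEquality using (_≡_)

-- A red/blue colouring of the edges of the complete ordered graph on
-- vertex set {0,…,N-1} (the order-isomorphic copy of [N]).  The colour of the
-- edge {i,j} with i < j is  c i j ; values c i j with i ≥ j or j ≥ N are
-- irrelevant.
Colouring : Set
Colouring = ℕ → ℕ → Bool

-- Ordered graphs on vertex set {0,…,n-1} with a (symmetric-by-convention)
-- edge relation, given as a predicate on ordered pairs i < j.
record OrdGraph : Set₁ where
  field
    size : ℕ
    Edge : ℕ → ℕ → Set   -- Edge i j meant for i < j < size

-- The i-th vertex (0-indexed position i) of the alternating path on t vertices,
-- with vertices 0-indexed {0,…,t-1}: the sequence t,1,t-1,2,… (1-indexed)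
-- becomes t-1,0,t-2,1,t-3,2,…
altVertex : ℕ → ℕ → ℕ
altVertex t i with i % 2
... | zero  = t ∸ 1 ∸ (i / 2)
... | suc _ = i / 2

AltEdge : ℕ → ℕ → ℕ → Set
AltEdge t a b = Σ ℕ λ i → (suc i < t) ×
  (((altVertex t i ≡ a) × (altVertex t (suc i) ≡ b)) Data.Sum.⊎
   ((altVertex t i ≡ b) × (altVertex t (suc i) ≡ a)))
  where import Data.Sum

AltP : ℕ → OrdGraph
AltP t = record { size = t ; Edge = λ a b → (a < b) × AltEdge t a b }

MonoCopy : (N : ℕ) → Colouring → Bool → OrdGraph → Set
MonoCopy N c col H =
  Σ (ℕ → ℕ) λ f →
    ((i j : ℕ) → i < j → j < OrdGraph.size H → f i < f j) ×
    ((i : ℕ) → i < OrdGraph.size H → f i < N) ×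
    ((i j : ℕ) → i < OrdGraph.size H → j < OrdGraph.size H →
       OrdGraph.Edge H i j → c (f i) (f j) ≡ col)

Arrows : ℕ → OrdGraph → Set
Arrows N H = (c : Colouring) → Σ Bool λ col → MonoCopy N c col H

-- R_<(H) ≤ M.  Since Arrows N H is monotone in N, the least N with
-- Arrows N H is ≤ M iff Arrows M H holds; we state the latter but phrase it
-- as existence of some N ≤ M for readability of the definition of R_<.
OrdRamseyLE : OrdGraph → ℕ → Set
OrdRamseyLE H M = Σ ℕ λ N → (N ≤ M) × Arrows N H

{-# OPTIONS --safe #-}

-- Let n = N − 1. The y-th vertex from the right end is n − y, so the edge between the x-th
-- vertex from the left and the y-th from the right is the cell (x , y) of the triangle
-- x + y < n, and an alternating path is a staircase of cells moving away from the corner (0 , 0).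
-- Each row and each column carries, for either colour, the length of a monochromatic staircase
-- ending in it. When a cell of that colour is met by a row with value a and a column with
-- value b, the larger one extends the other, which allows a + b to grow by exactly 2.
-- Over all N(N − 1)/2 cells the values therefore add up to n(n + 1). On the other hand, the two
-- values of a row (or column) x, which has n − x cells, add up to at most 2(n − x), to at most
-- 4x + 2, and to at most 4k if there is no monochromatic staircase of 2k + 1 cells.
-- For n = 6k + 2 these bounds only leave room for 36k² + 20k < n(n + 1).

module Submission where

open import Defs
open import Data.Nat using (ℕ; zero; suc; _+_; _*_; _∸_; _<_; _≤_; z≤n; s≤s; _<?_; ⌊_/2⌋)
open import Data.Nat.Properties
open import Data.Nat.DivMod using (m*n/n≡m; m*n%n≡0; [m+kn]%n≡m%n; +-distrib-/-∣ʳ)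
open import Data.Nat.Divisibility using (divides-refl)
open import Data.Nat.Tactic.RingSolver using (solve-∀)
open import Data.Bool using (Bool; true; false; if_then_else_)
import Data.Bool.Properties as Bool
open import Data.Product using (∃-syntax; _×_; _,_)
open import Data.Sum using (_⊎_; inj₁; inj₂)
open import Function using (flip)
open import Relation.Binary.PropositionalEquality using (_≡_; refl; sym; trans; cong; cong₂; subst; module ≡-Reasoning)
open import Relation.Nullary using (¬_; yes; no; does; contradiction)
open import Relation.Nullary.Decidable using (dec-true; dec-false)
open import Relation.Binary.Definitions using (tri<; tri≈; tri>)

-- Sums along antidiagonals

interchange : ∀ p q r s → p + q + (r + s) ≡ p + r + (q + s)
interchange = solve-∀

-- With `x + y = n`, line `x` has met exactly the `n - x` cells it has in the triangle, so such a
-- sum collects the final values of one side.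
antidiagSum : (ℕ → ℕ → ℕ) → ℕ → ℕ
antidiagSum f zero    = f 0 0
antidiagSum f (suc n) = f 0 (suc n) + antidiagSum (λ x y → f (suc x) y) n

antidiagSum-cong : ∀ {f g} → (∀ x y → f x y ≡ g x y) → ∀ n → antidiagSum f n ≡ antidiagSum g n
antidiagSum-cong f≗g zero    = f≗g 0 0
antidiagSum-cong f≗g (suc n) = cong₂ _+_ (f≗g 0 (suc n)) (antidiagSum-cong (λ x y → f≗g (suc x) y) n)

antidiagSum-last : ∀ f n → antidiagSum f (suc n) ≡ antidiagSum (λ x y → f x (suc y)) n + f (suc n) 0
antidiagSum-last f zero    = refl
antidiagSum-last f (suc n) = trans
  (cong (f 0 (suc (suc n)) +_) (antidiagSum-last (λ x y → f (suc x) y) n))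
  (sym (+-assoc (f 0 (suc (suc n))) _ _))

antidiagSum-flip : ∀ f n → antidiagSum (flip f) n ≡ antidiagSum f n
antidiagSum-flip f zero    = refl
antidiagSum-flip f (suc n) = begin
  f (suc n) 0 + antidiagSum (λ x y → f y (suc x)) n  ≡⟨ cong (f (suc n) 0 +_) (antidiagSum-flip (λ x y → f x (suc y)) n) ⟩
  f (suc n) 0 + antidiagSum (λ x y → f x (suc y)) n  ≡⟨ +-comm (f (suc n) 0) _ ⟩
  antidiagSum (λ x y → f x (suc y)) n + f (suc n) 0  ≡⟨ antidiagSum-last f n ⟨
  antidiagSum f (suc n)                              ∎
  where open ≡-Reasoning

antidiagSum-+ : ∀ f g n → antidiagSum (λ x y → f x y + g x y) n ≡ antidiagSum f n + antidiagSum g n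
antidiagSum-+ f g zero    = refl
antidiagSum-+ f g (suc n) = trans
  (cong (f 0 (suc n) + g 0 (suc n) +_) (antidiagSum-+ (λ x y → f (suc x) y) (λ x y → g (suc x) y) n))
  (interchange (f 0 (suc n)) (g 0 (suc n)) _ _)

antidiagSum-const : ∀ a n → antidiagSum (λ _ _ → a) n ≡ suc n * a
antidiagSum-const a zero    = sym (+-identityʳ a)
antidiagSum-const a (suc n) = cong (a +_) (antidiagSum-const a n)

antidiagSum≤-triangle : ∀ f n → (∀ x y → f x y ≤ 2 * y) → antidiagSum f n ≤ n * suc n
antidiagSum≤-triangle f zero    f≤ = f≤ 0 0
antidiagSum≤-triangle f (suc n) f≤ = begin
  f 0 (suc n) + antidiagSum (λ x y → f (suc x) y) n  ≤⟨ +-mono-≤ (f≤ 0 (suc n)) (antidiagSum≤-triangle _ n (λ x → f≤ (suc x))) ⟩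
  2 * suc n + n * suc n                              ≡⟨ arith n ⟩
  suc n * suc (suc n)                                ∎
  where
  open ≤-Reasoning
  arith : ∀ n → 2 * suc n + n * suc n ≡ suc n * suc (suc n)
  arith = solve-∀

antidiagSum≤-trapezium : ∀ M f m n → (∀ x y → f x y ≤ 2 * y) → (∀ x y → x + y ≡ m + n → f x y ≤ M) →
  antidiagSum f (m + n) ≤ m * M + n * suc n
antidiagSum≤-trapezium M f zero    n f≤ f≤M = antidiagSum≤-triangle f n f≤
antidiagSum≤-trapezium M f (suc m) n f≤ f≤M = begin
  f 0 (suc m + n) + antidiagSum (λ x y → f (suc x) y) (m + n)  ≤⟨ +-mono-≤ (f≤M 0 _ refl) (antidiagSum≤-trapezium M _ m n (λ x → f≤ (suc x)) (λ x y eq → f≤M (suc x) y (cong suc eq))) ⟩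
  M + (m * M + n * suc n)                                      ≡⟨ +-assoc M (m * M) _ ⟨
  suc m * M + n * suc n                                        ∎
  where open ≤-Reasoning

-- The offset e is what makes the shift x ↦ suc x inductive.
antidiagSum≤-head : ∀ e f k n → (∀ x y → f x y ≤ 4 * x + (2 + e)) →
  antidiagSum f (k + n) ≤ 2 * (k * k) + k * e + antidiagSum (λ x y → f (k + x) y) n
antidiagSum≤-head e f zero    n f≤ = ≤-refl
antidiagSum≤-head e f (suc k) n f≤ = begin
  f 0 (suc k + n) + antidiagSum (λ x y → f (suc x) y) (k + n)  ≤⟨ +-mono-≤ (f≤ 0 _) (antidiagSum≤-head (4 + e) _ k n (λ x y → ≤-trans (f≤ (suc x) y) (≤-reflexive (shift x e)))) ⟩
  2 + e + (2 * (k * k) + k * (4 + e) + S)                      ≡⟨ arith e k S ⟩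
  2 * (suc k * suc k) + suc k * e + S                          ∎
  where
  open ≤-Reasoning
  S = antidiagSum (λ x y → f (suc k + x) y) n
  shift : ∀ x e → 4 * suc x + (2 + e) ≡ 4 * x + (2 + (4 + e))
  shift = solve-∀
  arith : ∀ e k S → 2 + e + (2 * (k * k) + k * (4 + e) + S) ≡ 2 * (suc k * suc k) + suc k * e + S
  arith = solve-∀

large-or-bounded : ∀ M (f : ℕ → ℕ → ℕ) n → (∃[ x ] ∃[ y ] x + y ≡ n × M < f x y) ⊎ (∀ x y → x + y ≡ n → f x y ≤ M)
large-or-bounded M f n with M <? f 0 n
... | yes M<f = inj₁ (0 , n , refl , M<f)
large-or-bounded M f zero | no M≮f = inj₂ λ { zero zero refl → ≮⇒≥ M≮f }
large-or-bounded M f (suc n) | no M≮f with large-or-bounded M (λ x y → f (suc x) y) n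
... | inj₁ (x , y , eq , M<f) = inj₁ (suc x , y , cong suc eq , M<f)
... | inj₂ f≤M = inj₂ λ { zero y refl → ≮⇒≥ M≮f ; (suc x) y eq → f≤M x y (suc-injective eq) }

-- The growth rule at a crossing

-- The new value of a line with value a crossing a line with value b: min(a + 2, b + 1) if
-- a ≤ b, and a otherwise.
grow : ℕ → ℕ → ℕ
grow zero    zero    = 1
grow zero    (suc b) = 2
grow (suc a) zero    = suc a
grow (suc a) (suc b) = suc (grow a b)

grow-sum : ∀ a b → grow a b + grow b a ≡ 2 + (a + b)
grow-sum zero    zero    = refl
grow-sum zero    (suc b) = refl
grow-sum (suc a) zero    = trans (+-comm (suc a) 2) (cong (2 +_) (sym (+-identityʳ (suc a))))
grow-sum (suc a) (suc b) = cong suc (begin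
  grow a b + suc (grow b a)  ≡⟨ +-suc _ _ ⟩
  suc (grow a b + grow b a)  ≡⟨ cong suc (grow-sum a b) ⟩
  suc (2 + (a + b))          ≡⟨ cong (2 +_) (+-suc a b) ⟨
  2 + (a + suc b)            ∎)
  where open ≡-Reasoning

grow≤2+ : ∀ a b → grow a b ≤ 2 + a
grow≤2+ zero    zero    = s≤s z≤n
grow≤2+ zero    (suc b) = ≤-refl
grow≤2+ (suc a) zero    = m≤n+m (suc a) 2
grow≤2+ (suc a) (suc b) = s≤s (grow≤2+ a b)

-- A value that changes must be realised by appending the new cell to the staircase of the crossing
-- line, whose length is `b`.
grow-cases : ∀ a b → grow a b ≡ a ⊎ grow a b ≤ suc b
grow-cases zero    zero    = inj₂ ≤-refl
grow-cases zero    (suc b) = inj₂ (s≤s (s≤s z≤n))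
grow-cases (suc a) zero    = inj₁ refl
grow-cases (suc a) (suc b) with grow-cases a b
... | inj₁ eq = inj₁ (cong suc eq)
... | inj₂ le = inj₂ (s≤s le)

-- Monochromatic staircases and line values

data Side : Set where
  left right : Side

opp : Side → Side
opp left  = right
opp right = left

opp-involutive : ∀ s → opp (opp s) ≡ s
opp-involutive left  = refl
opp-involutive right = refl

module Staircases (n : ℕ) (c : Colouring) where

  -- Lines on the left side are counted from vertex 0 upwards, those on the right side from
  -- vertex n downwards.
  edgeColour : Side → ℕ → ℕ → Bool
  edgeColour left  x y = c x (n ∸ y)
  edgeColour right y x = c x (n ∸ y)

  edgeColour-opp : ∀ s u v → edgeColour (opp s) u v ≡ edgeColour s v u
  edgeColour-opp left  u v = refl
  edgeColour-opp right u v = refl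

  -- Path k s ℓ v b: a staircase of ℓ cells of colour k, ending at line v of side s, that only
  -- uses lines < b of the opposite side.
  data Path (k : Bool) : Side → ℕ → ℕ → ℕ → Set where
    start : ∀ {s v b} → Path k s 0 v b
    step  : ∀ {s ℓ v b u} → u < b → v + u < n → edgeColour s v u ≡ k →
            Path k (opp s) ℓ u v → Path k s (suc ℓ) v b

  widen : ∀ {k s ℓ v b b′} → b ≤ b′ → Path k s ℓ v b → Path k s ℓ v b′
  widen b≤b′ start               = start
  widen b≤b′ (step u<b lt col p) = step (≤-trans u<b b≤b′) lt col p

  -- Cells are dropped at the starting end, so the final line and the bound survive.
  truncate : ∀ {k s ℓ ℓ′ v b} → ℓ′ ≤ ℓ → Path k s ℓ v b → Path k s ℓ′ v b
  truncate z≤n       p                   = start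
  truncate (s≤s ℓ′≤ℓ) (step u<b lt col p) = step u<b lt col (truncate ℓ′≤ℓ p)

  -- The value of line v of side s after crossing the first b lines of the opposite side.
  rank : Bool → Side → ℕ → ℕ → ℕ
  rank k s v zero    = 0
  -- Just before the cell `(v , b)`, line `v` has crossed `b` lines and line `b` has crossed `v`
  -- lines.
  rank k s v (suc b) = if does (edgeColour s v b Bool.≟ k)
    then grow (rank k s v b) (rank k (opp s) b v)
    else rank k s v b

  rank≤2* : ∀ k s v b → rank k s v b ≤ 2 * b
  rank≤2* k s v zero    = z≤n
  rank≤2* k s v (suc b) rewrite *-suc 2 b with edgeColour s v b Bool.≟ k
  ... | yes _ = ≤-trans (grow≤2+ (rank k s v b) _) (+-monoʳ-≤ 2 (rank≤2* k s v b))
  ... | no  _ = ≤-trans (rank≤2* k s v b) (m≤n+m (2 * b) 2)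

  -- A value that changes ends at most 1 above that of the crossing line, which has itself crossed
  -- only `v` lines.
  rank≤1+2* : ∀ k s v b → rank k s v b ≤ 1 + 2 * v
  rank≤1+2* k s v zero    = z≤n
  rank≤1+2* k s v (suc b) with edgeColour s v b Bool.≟ k
  ... | no  _ = rank≤1+2* k s v b
  ... | yes _ with grow-cases (rank k s v b) (rank k (opp s) b v)
  ...   | inj₁ eq rewrite eq = rank≤1+2* k s v b
  ...   | inj₂ le = ≤-trans le (s≤s (rank≤2* k (opp s) b v))

  rank-path : ∀ k s v b → v + b ≤ n → Path k s (rank k s v b) v b
  rank-path k s v zero    v+b≤n = start
  rank-path k s v (suc b) v+b≤n with edgeColour s v b Bool.≟ k
  ... | no  _   = widen (n≤1+n b) (rank-path k s v b (≤-trans (+-monoʳ-≤ v (n≤1+n b)) v+b≤n))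
  ... | yes col with grow-cases (rank k s v b) (rank k (opp s) b v)
  ...   | inj₁ eq rewrite eq = widen (n≤1+n b) (rank-path k s v b (≤-trans (+-monoʳ-≤ v (n≤1+n b)) v+b≤n))
  ...   | inj₂ le = truncate le (step ≤-refl v+b<n col (rank-path k (opp s) b v (subst (_≤ n) (+-comm v b) (<⇒≤ v+b<n))))
    where
    v+b<n : v + b < n
    v+b<n = subst (_≤ n) (+-suc v b) v+b≤n

  totalRank : Side → ℕ → ℕ → ℕ
  totalRank s v b = rank true s v b + rank false s v b

  -- Each cell has one colour, so it raises only one of the two summands; hence the bound for a
  -- single colour also holds for the sum.
  totalRank≤2* : ∀ s v b → totalRank s v b ≤ 2 * b
  totalRank≤2* s v zero    = z≤n
  totalRank≤2* s v (suc b) rewrite *-suc 2 b with edgeColour s v b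
  ... | true  = ≤-trans (+-monoˡ-≤ (rank false s v b) (grow≤2+ (rank true s v b) _)) (+-monoʳ-≤ 2 (totalRank≤2* s v b))
  ... | false = ≤-trans (+-monoʳ-≤ (rank true s v b) (grow≤2+ (rank false s v b) _))
                  (≤-trans (≤-reflexive (arith (rank true s v b) _)) (+-monoʳ-≤ 2 (totalRank≤2* s v b)))
    where
    arith : ∀ p q → p + (2 + q) ≡ 2 + (p + q)
    arith = solve-∀

  totalRank≤4*+2 : ∀ s v b → totalRank s v b ≤ 4 * v + 2
  totalRank≤4*+2 s v b = ≤-trans (+-mono-≤ (rank≤1+2* true s v b) (rank≤1+2* false s v b)) (≤-reflexive (arith v))
    where
    arith : ∀ v → 1 + 2 * v + (1 + 2 * v) ≡ 4 * v + 2
    arith = solve-∀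

  totalRank-step : ∀ x y → totalRank left x (suc y) + totalRank right y (suc x) ≡
                           2 + (totalRank left x y + totalRank right y x)
  totalRank-step x y with c x (n ∸ y)
  ... | true  = begin
    grow a a′ + b + (grow a′ a + b′)    ≡⟨ interchange (grow a a′) b (grow a′ a) b′ ⟩
    grow a a′ + grow a′ a + (b + b′)    ≡⟨ cong (_+ (b + b′)) (grow-sum a a′) ⟩
    2 + (a + a′ + (b + b′))             ≡⟨ cong (2 +_) (interchange a a′ b b′) ⟩
    2 + (a + b + (a′ + b′))             ∎
    where
    open ≡-Reasoning
    a  = rank true left x y
    a′ = rank true right y x
    b  = rank false left x y
    b′ = rank false right y x
  ... | false = begin
    a + grow b b′ + (a′ + grow b′ b)    ≡⟨ interchange a (grow b b′) a′ (grow b′ b) ⟩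
    a + a′ + (grow b b′ + grow b′ b)    ≡⟨ cong (a + a′ +_) (grow-sum b b′) ⟩
    a + a′ + (2 + (b + b′))             ≡⟨ arith a a′ b b′ ⟩
    2 + (a + b + (a′ + b′))             ∎
    where
    open ≡-Reasoning
    a  = rank true left x y
    a′ = rank true right y x
    b  = rank false left x y
    b′ = rank false right y x
    arith : ∀ p r q s → p + r + (2 + (q + s)) ≡ 2 + (p + q + (r + s))
    arith = solve-∀

  -- Passing from antidiagonal `m` to `m + 1` processes `m + 1` cells, each worth 2 by
  -- `totalRank-step`; the line that joins has met no cell and contributes 0.
  totalRank-antidiagSum : ∀ m → antidiagSum (totalRank left) m + antidiagSum (totalRank right) m ≡ m * suc m
  totalRank-antidiagSum zero    = refl
  totalRank-antidiagSum (suc m) = begin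
    antidiagSum L (suc m) + antidiagSum R (suc m)
      ≡⟨ cong₂ _+_ (antidiagSum-last L m) (antidiagSum-last R m) ⟩
    antidiagSum (λ x y → L x (suc y)) m + 0 + (antidiagSum (λ y x → R y (suc x)) m + 0)
      ≡⟨ cong₂ _+_ (+-identityʳ (antidiagSum (λ x y → L x (suc y)) m)) (+-identityʳ _) ⟩
    antidiagSum (λ x y → L x (suc y)) m + antidiagSum (λ y x → R y (suc x)) m
      ≡⟨ cong (antidiagSum (λ x y → L x (suc y)) m +_) (antidiagSum-flip (λ y x → R y (suc x)) m) ⟨
    antidiagSum (λ x y → L x (suc y)) m + antidiagSum (λ x y → R y (suc x)) m
      ≡⟨ antidiagSum-+ (λ x y → L x (suc y)) (λ x y → R y (suc x)) m ⟨
    antidiagSum (λ x y → L x (suc y) + R y (suc x)) m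
      ≡⟨ antidiagSum-cong totalRank-step m ⟩
    antidiagSum (λ x y → 2 + (L x y + R y x)) m
      ≡⟨ antidiagSum-+ (λ _ _ → 2) (λ x y → L x y + R y x) m ⟩
    antidiagSum (λ _ _ → 2) m + antidiagSum (λ x y → L x y + R y x) m
      ≡⟨ cong₂ _+_ (antidiagSum-const 2 m) (antidiagSum-+ L (flip R) m) ⟩
    suc m * 2 + (antidiagSum L m + antidiagSum (flip R) m)
      ≡⟨ cong (λ z → suc m * 2 + (antidiagSum L m + z)) (antidiagSum-flip R m) ⟩
    suc m * 2 + (antidiagSum L m + antidiagSum R m)
      ≡⟨ cong (suc m * 2 +_) (totalRank-antidiagSum m) ⟩
    suc m * 2 + m * suc m
      ≡⟨ arith m ⟩
    suc m * suc (suc m) ∎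
    where
    open ≡-Reasoning
    L = totalRank left
    R = totalRank right
    arith : ∀ m → suc m * 2 + m * suc m ≡ suc m * suc (suc m)
    arith = solve-∀

  LongPath : ℕ → Set
  LongPath ℓ = ∃[ k ] ∃[ s ] ∃[ v ] ∃[ b ] Path k s ℓ v b

  large-totalRank⇒path : ∀ k s v b → v + b ≡ n → 4 * k < totalRank s v b → LongPath (suc (2 * k))
  large-totalRank⇒path k s v b v+b≡n 4k< with 2 * k <? rank true s v b | 2 * k <? rank false s v b
  ... | yes lt | _      = true  , s , v , b , truncate lt (rank-path true s v b (≤-reflexive v+b≡n))
  ... | no _   | yes lt = false , s , v , b , truncate lt (rank-path false s v b (≤-reflexive v+b≡n))
  ... | no ≮₁  | no ≮₂  = contradiction 4k< (≤⇒≯ (≤-trans (+-mono-≤ (≮⇒≥ ≮₁) (≮⇒≥ ≮₂)) (≤-reflexive (arith k))))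
    where
    arith : ∀ k → 2 * k + 2 * k ≡ 4 * k
    arith = solve-∀

  long-path : ∀ k → n ≡ 2 + 6 * k → LongPath (suc (2 * k))
  long-path k n≡ with large-or-bounded (4 * k) (totalRank left) n | large-or-bounded (4 * k) (totalRank right) n
  ... | inj₁ (x , y , eq , lt) | _ = large-totalRank⇒path k left x y eq lt
  ... | inj₂ _ | inj₁ (x , y , eq , lt) = large-totalRank⇒path k right x y eq lt
  ... | inj₂ L≤ | inj₂ R≤ = contradiction (totalRank-antidiagSum n) (<⇒≢ (begin-strict
    antidiagSum (totalRank left) n + antidiagSum (totalRank right) n  ≤⟨ +-mono-≤ (sum≤ left L≤) (sum≤ right R≤) ⟩
    bound + bound                                                     <⟨ m<m+n (bound + bound) {6 + 10 * k} (s≤s z≤n) ⟩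
    bound + bound + (6 + 10 * k)                                      ≡⟨ arith k ⟩
    (2 + 6 * k) * suc (2 + 6 * k)                                     ≡⟨ cong (λ m → m * suc m) n≡ ⟨
    n * suc n                                                         ∎))
    where
    open ≤-Reasoning
    -- The first `k` lines are bounded by `4 * x + 2`, the next `2 + 3 * k` by `4 * k`, and the last
    -- `2 * k + 1` by `2 * y`; the switches occur where these bounds cross.
    bound = 2 * (k * k) + k * 0 + ((2 + 3 * k) * (4 * k) + 2 * k * suc (2 * k))
    arith : ∀ k → 2 * (k * k) + k * 0 + ((2 + 3 * k) * (4 * k) + 2 * k * suc (2 * k))
                + (2 * (k * k) + k * 0 + ((2 + 3 * k) * (4 * k) + 2 * k * suc (2 * k))) + (6 + 10 * k)
                ≡ (2 + 6 * k) * suc (2 + 6 * k)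
    arith = solve-∀
    split : ∀ k → 2 + 6 * k ≡ k + (2 + 3 * k + 2 * k)
    split = solve-∀
    n≡′ : n ≡ k + (2 + 3 * k + 2 * k)
    n≡′ = trans n≡ (split k)
    sum≤ : ∀ s → (∀ x y → x + y ≡ n → totalRank s x y ≤ 4 * k) → antidiagSum (totalRank s) n ≤ bound
    sum≤ s r≤ = begin
      antidiagSum (totalRank s) n                              ≡⟨ cong (antidiagSum (totalRank s)) n≡′ ⟩
      antidiagSum (totalRank s) (k + (2 + 3 * k + 2 * k))      ≤⟨ antidiagSum≤-head 0 (totalRank s) k _ (totalRank≤4*+2 s) ⟩
      2 * (k * k) + k * 0 + antidiagSum (λ x y → totalRank s (k + x) y) (2 + 3 * k + 2 * k)
        ≤⟨ +-monoʳ-≤ (2 * (k * k) + k * 0) (antidiagSum≤-trapezium (4 * k) _ (2 + 3 * k) (2 * k)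
             (λ x → totalRank≤2* s (k + x))
             (λ x y eq → r≤ (k + x) y (trans (+-assoc k x y) (trans (cong (k +_) eq) (sym n≡′))))) ⟩
      bound ∎

  -- Staircases as vertex sequences

  sideAt : ℕ → Side
  -- The alternating path begins at its largest vertex.
  sideAt zero    = right
  sideAt (suc i) = opp (sideAt i)

  record Zigzag (k : Bool) (ℓ : ℕ) : Set where
    field
      at       : ℕ → ℕ
      coloured : ∀ i → i < ℓ → edgeColour (sideAt i) (at i) (at (suc i)) ≡ k
      below    : ∀ i → i < ℓ → at i + at (suc i) < n
      nested   : ∀ i → suc i < ℓ → at i < at (2 + i)

  -- Path vertices indexed backwards, with index 0 at the last vertex.
  fromEnd : ∀ {k s ℓ v b} → Path k s ℓ v b → ℕ → ℕ
  -- Index 0 here is the first vertex of the path; larger indices are out of range and repeat it.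
  fromEnd {v = v} start            j       = v
  fromEnd {v = v} (step _ _ _ p)   zero    = v
  fromEnd         (step _ _ _ p)   (suc j) = fromEnd p j

  fromEnd-zero : ∀ {k s ℓ v b} (p : Path k s ℓ v b) → fromEnd p 0 ≡ v
  fromEnd-zero start          = refl
  fromEnd-zero (step _ _ _ p) = refl

  -- Since `suc (i + j) ≡ ℓ`, the backward indices `suc j` and `j` are the forward indices `i` and
  -- `suc i`.
  fromEnd-coloured : ∀ {k s ℓ v b} (p : Path k s ℓ v b) → s ≡ sideAt ℓ → ∀ i j → suc (i + j) ≡ ℓ →
    edgeColour (sideAt i) (fromEnd p (suc j)) (fromEnd p j) ≡ k
  fromEnd-coloured {v = v} (step {u = u} _ _ col p) refl i zero refl
    rewrite fromEnd-zero p | +-identityʳ i = trans (sym (edgeColour-opp (sideAt i) v u)) col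
  fromEnd-coloured (step {ℓ = ℓ} _ _ _ p) refl i (suc j) eq =
    fromEnd-coloured p (opp-involutive (sideAt ℓ)) i j (trans (sym (+-suc i j)) (suc-injective eq))

  fromEnd-below : ∀ {k s ℓ v b} (p : Path k s ℓ v b) j → j < ℓ → fromEnd p (suc j) + fromEnd p j < n
  fromEnd-below {v = v} (step {u = u} _ lt _ p) zero _ rewrite fromEnd-zero p = subst (_< n) (+-comm v u) lt
  fromEnd-below (step _ _ _ p) (suc j) (s≤s j<ℓ) = fromEnd-below p j j<ℓ

  fromEnd-nested : ∀ {k s ℓ v b} (p : Path k s ℓ v b) j → suc j < ℓ → fromEnd p (2 + j) < fromEnd p j
  fromEnd-nested (step _ _ _ (step u<v _ _ p)) zero _ rewrite fromEnd-zero p = u<v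
  fromEnd-nested (step _ _ _ p) (suc j) (s≤s j<ℓ) = fromEnd-nested p j j<ℓ

  path⇒zigzag : ∀ {k ℓ v b} → Path k (sideAt ℓ) ℓ v b → Zigzag k ℓ
  path⇒zigzag {k} {ℓ} p = record
    { at       = at
    ; coloured = λ i i<ℓ → subst (λ z → edgeColour (sideAt i) (fromEnd p z) (at (suc i)) ≡ k) (sym (∸-step i<ℓ))
                   (fromEnd-coloured p refl i (ℓ ∸ suc i) (m+[n∸m]≡n i<ℓ))
    ; below    = λ i i<ℓ → subst (λ z → fromEnd p z + at (suc i) < n) (sym (∸-step i<ℓ))
                   (fromEnd-below p (ℓ ∸ suc i) (∸-< i<ℓ))
    ; nested   = λ i 1+i<ℓ → subst (λ z → fromEnd p z < at (2 + i))
                   (sym (trans (∸-step (<⇒≤ 1+i<ℓ)) (cong suc (∸-step 1+i<ℓ)))) 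
                   (fromEnd-nested p (ℓ ∸ (2 + i)) (subst (_< ℓ) (∸-step 1+i<ℓ) (∸-< (<⇒≤ 1+i<ℓ))))
    }
    where
    at : ℕ → ℕ
    at i = fromEnd p (ℓ ∸ i)
    ∸-step : ∀ {i} → i < ℓ → ℓ ∸ i ≡ suc (ℓ ∸ suc i)
    ∸-step = +-∸-assoc 1
    ∸-< : ∀ {i} → i < ℓ → ℓ ∸ suc i < ℓ
    ∸-< {i} i<ℓ = subst (_≤ ℓ) (∸-step i<ℓ) (m∸n≤m ℓ i)

-- `Zigzag.nested` compares only vertices two steps apart; chaining it orders all the vertices on
-- one side.
double-step-mono : ∀ (w : ℕ → ℕ) ℓ → (∀ i → 2 + i < ℓ → w i < w (2 + i)) →
  ∀ {p} q → p < q → q * 2 < ℓ → w (p * 2) < w (q * 2)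
double-step-mono w ℓ inc {p} (suc q) (s≤s p≤q) 2+2q<ℓ with m≤n⇒m<n∨m≡n p≤q
... | inj₂ refl = inc (q * 2) 2+2q<ℓ
... | inj₁ p<q  = <-trans (double-step-mono w ℓ inc q p<q (<-trans (m<n+m (q * 2) (s≤s z≤n)) 2+2q<ℓ)) (inc (q * 2) 2+2q<ℓ)

-- Positions in the alternating path

data Parity : ℕ → Set where
  even : ∀ q → Parity (q * 2)
  odd  : ∀ q → Parity (suc (q * 2))

parity : ∀ i → Parity i
parity zero = even 0
parity (suc i) with parity i
... | even q = odd q
... | odd q  = even (suc q)

altVertex-even : ∀ t q → altVertex t (q * 2) ≡ t ∸ 1 ∸ q
altVertex-even t q rewrite m*n%n≡0 q 2 {{_}} | m*n/n≡m q 2 {{_}} = refl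

altVertex-odd : ∀ t q → altVertex t (suc (q * 2)) ≡ q
altVertex-odd t q rewrite [m+kn]%n≡m%n 1 q 2 {{_}} =
  trans (+-distrib-/-∣ʳ 1 {q * 2} {2} (divides-refl q)) (m*n/n≡m q 2)

-- From a zigzag to a monochromatic copy

module Embedding (n : ℕ) (c : Colouring) (k : Bool) (ℓ : ℕ) (Z : Staircases.Zigzag n c k ℓ) where
  open Staircases n c
  open Zigzag Z

  L R : ℕ → ℕ
  L q = at (suc (q * 2))
  R q = at (q * 2)

  L-mono : ∀ {p} q → p < q → q * 2 < ℓ → L p < L q
  L-mono = double-step-mono (λ i → at (suc i)) ℓ (λ i lt → nested (suc i) lt)

  R-mono : ∀ {p} q → p < q → q * 2 ≤ ℓ → R p < R q
  -- The bound is `suc ℓ` because `ℓ` edges have `ℓ + 1` vertices.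
  R-mono q p<q 2q≤ℓ = double-step-mono at (suc ℓ) (λ { i (s≤s lt) → nested i lt }) q p<q (s≤s 2q≤ℓ)

  -- Every left vertex lies before every right one: by monotonicity on the side that is less far in,
  -- the pair is compared with two consecutive vertices, where `below` applies.
  L+R<n : ∀ p q → p * 2 < ℓ → q * 2 ≤ ℓ → L p + R q < n
  L+R<n p q 2p<ℓ 2q≤ℓ with <-cmp p q
  ... | tri≈ _ refl _ = subst (_< n) (+-comm (R p) (L p)) (below (p * 2) 2p<ℓ)
  ... | tri> _ _ q<p  = <-trans (+-monoʳ-< (L p) (R-mono p q<p (<⇒≤ 2p<ℓ))) (subst (_< n) (+-comm (R p) (L p)) (below (p * 2) 2p<ℓ))
  L+R<n p (suc q) 2p<ℓ 2q≤ℓ | tri< (s≤s p≤q) _ _ = ≤-<-trans (+-monoˡ-≤ (R (suc q)) Lp≤Lq) (below (suc (q * 2)) 2q≤ℓ)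
    where
    Lp≤Lq : L p ≤ L q
    Lp≤Lq with m≤n⇒m<n∨m≡n p≤q
    ... | inj₁ p<q  = <⇒≤ (L-mono q p<q (<⇒≤ 2q≤ℓ))
    ... | inj₂ refl = ≤-refl

  -- Vertex `j` of the alternating path has position `2j + 1` in its sequence if `2j < ℓ`, and
  -- position `2(ℓ - j)` otherwise.
  embed : ℕ → ℕ
  embed j = if does (j * 2 <? ℓ) then L j else n ∸ R (ℓ ∸ j)

  embed-left : ∀ j → j * 2 < ℓ → embed j ≡ L j
  embed-left j lt rewrite dec-true (j * 2 <? ℓ) lt = refl

  embed-right : ∀ j → ¬ (j * 2 < ℓ) → embed j ≡ n ∸ R (ℓ ∸ j)
  embed-right j ≮ rewrite dec-false (j * 2 <? ℓ) ≮ = refl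

  right-index : ∀ j → ¬ (j * 2 < ℓ) → (ℓ ∸ j) * 2 ≤ ℓ
  right-index j ≮ = begin
    (ℓ ∸ j) * 2    ≡⟨ *-distribʳ-∸ 2 ℓ j ⟩
    ℓ * 2 ∸ j * 2  ≤⟨ ∸-monoʳ-≤ (ℓ * 2) (≮⇒≥ ≮) ⟩
    ℓ * 2 ∸ ℓ      ≡⟨ cong (_∸ ℓ) (*-comm ℓ 2) ⟩
    ℓ + (ℓ + 0) ∸ ℓ  ≡⟨ m+n∸m≡n ℓ (ℓ + 0) ⟩
    ℓ + 0          ≡⟨ +-identityʳ ℓ ⟩
    ℓ              ∎
    where open ≤-Reasoning

  embed-mono : ∀ i j → i < j → j < suc ℓ → embed i < embed j
  embed-mono i j i<j (s≤s j≤ℓ) with i * 2 <? ℓ | j * 2 <? ℓ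
  ... | yes lt | yes lt′ rewrite embed-left i lt | embed-left j lt′ = L-mono j i<j lt′
  ... | yes lt | no ≮ rewrite embed-left i lt | embed-right j ≮ = m+n≤o⇒m≤o∸n (suc (L i)) (L+R<n i (ℓ ∸ j) lt (right-index j ≮))
  ... | no ≮ | yes lt = contradiction (<-trans (*-monoˡ-< 2 i<j) lt) ≮
  -- Strictness of truncated subtraction needs `R (ℓ ∸ i) ≤ n`, which comes from comparison with
  -- `L 0`.
  ... | no ≮ | no ≮′ rewrite embed-right i ≮ | embed-right j ≮′ = ∸-monoʳ-< (R-mono (ℓ ∸ i) (∸-monoʳ-< i<j j≤ℓ) (right-index i ≮))
                            (m+n≤o⇒n≤o (L 0) (<⇒≤ (L+R<n 0 (ℓ ∸ i) (≤-<-trans z≤n (<-≤-trans i<j j≤ℓ)) (right-index i ≮))))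

  embed-bound : ∀ i → embed i < suc n
  embed-bound i with i * 2 <? ℓ
  ... | yes lt rewrite embed-left i lt = m<n⇒m<1+n (≤-<-trans (m≤m+n (L i) (R 0)) (L+R<n i 0 lt z≤n))
  ... | no ≮ rewrite embed-right i ≮ = s≤s (m∸n≤m n (R (ℓ ∸ i)))

  embed-odd : ∀ q → suc (q * 2) ≤ ℓ → embed (altVertex (suc ℓ) (suc (q * 2))) ≡ L q
  embed-odd q lt = trans (cong embed (altVertex-odd (suc ℓ) q)) (embed-left q lt)

  embed-even : ∀ q → q * 2 ≤ ℓ → embed (altVertex (suc ℓ) (q * 2)) ≡ n ∸ R q
  embed-even q le = begin
    embed (altVertex (suc ℓ) (q * 2))  ≡⟨ cong embed (altVertex-even (suc ℓ) q) ⟩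
    embed (ℓ ∸ q)                      ≡⟨ embed-right (ℓ ∸ q) (≤⇒≯ ℓ≤) ⟩
    n ∸ R (ℓ ∸ (ℓ ∸ q))                ≡⟨ cong (λ z → n ∸ R z) (m∸[m∸n]≡n (≤-trans (m≤m*n q 2) le)) ⟩
    n ∸ R q                            ∎
    where
    open ≡-Reasoning
    ℓ≤ : ℓ ≤ (ℓ ∸ q) * 2
    ℓ≤ = subst (ℓ ≤_) (sym (*-distribʳ-∸ 2 ℓ q)) (m+n≤o⇒m≤o∸n ℓ
           (≤-trans (+-monoʳ-≤ ℓ le) (≤-reflexive (sym (trans (*-comm ℓ 2) (cong (ℓ +_) (+-identityʳ ℓ)))))))

  sideAt-even : ∀ q → sideAt (q * 2) ≡ right
  sideAt-even zero    = refl
  sideAt-even (suc q) = trans (opp-involutive (sideAt (q * 2))) (sideAt-even q)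

  -- Consecutive path vertices i, i + 1 in increasing order: the odd-indexed one is the left end.
  embed-edge : ∀ i → i < ℓ →
    let a = embed (altVertex (suc ℓ) i) ; b = embed (altVertex (suc ℓ) (suc i)) in
    (a < b × c a b ≡ k) ⊎ (b < a × c b a ≡ k)
  embed-edge i i<ℓ with parity i
  ... | even q rewrite embed-even q (<⇒≤ i<ℓ) | embed-odd q i<ℓ =
    inj₂ (m+n≤o⇒m≤o∸n (suc (L q)) (L+R<n q q i<ℓ (<⇒≤ i<ℓ))
         , trans (cong (λ s → edgeColour s (R q) (L q)) (sym (sideAt-even q))) (coloured (q * 2) i<ℓ))
  ... | odd q rewrite embed-even (suc q) i<ℓ | embed-odd q (<⇒≤ i<ℓ) =
    inj₁ (m+n≤o⇒m≤o∸n (suc (L q)) (L+R<n q (suc q) (<⇒≤ i<ℓ) i<ℓ)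
         , trans (cong (λ s → edgeColour (opp s) (L q) (R (suc q))) (sym (sideAt-even q))) (coloured (suc (q * 2)) i<ℓ))

  edges : ∀ i j → i < suc ℓ → j < suc ℓ → OrdGraph.Edge (AltP (suc ℓ)) i j → c (embed i) (embed j) ≡ k
  edges i j _ j<t (i<j , m , s≤s m<ℓ , inj₁ (refl , refl)) with embed-edge m m<ℓ
  ... | inj₁ (_ , col) = col
  -- The reverse orientation contradicts monotonicity of `embed`.
  ... | inj₂ (lt , _)  = contradiction (embed-mono i j i<j j<t) (<-asym lt)
  edges i j _ j<t (i<j , m , s≤s m<ℓ , inj₂ (refl , refl)) with embed-edge m m<ℓ
  ... | inj₂ (_ , col) = col
  ... | inj₁ (lt , _)  = contradiction (embed-mono i j i<j j<t) (<-asym lt)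

  monoCopy : MonoCopy (suc n) c k (AltP (suc ℓ))
  monoCopy = embed , embed-mono , (λ i _ → embed-bound i) , edges

-- Adjusting parity and length

same-or-opposite : ∀ s s′ → s ≡ s′ ⊎ opp s ≡ s′
same-or-opposite left  left  = inj₁ refl
same-or-opposite left  right = inj₂ refl
same-or-opposite right left  = inj₂ refl
same-or-opposite right right = inj₁ refl

-- Dropping either the first or the last edge fixes the side on which the path starts.
path⇒monoCopy : ∀ n c ℓ → Staircases.LongPath n c (suc ℓ) → ∃[ k ] MonoCopy (suc n) c k (AltP (suc ℓ))
path⇒monoCopy n c ℓ (k , s , v , b , p@(Staircases.step _ _ _ p′)) = k , Embedding.monoCopy n c k ℓ zigzag
  where
  open Staircases n c
  zigzag : Zigzag k ℓ
  zigzag with same-or-opposite s (sideAt ℓ)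
  ... | inj₁ refl = path⇒zigzag (truncate (n≤1+n ℓ) p)
  ... | inj₂ eq   = path⇒zigzag (subst (λ s → Path k s ℓ _ _) eq p′)

theorem3p1 : (t : ℕ) → OrdRamseyLE (AltP t) (3 * t + 3)
theorem3p1 zero    = 0 , z≤n , λ c → true , (λ i → i) , (λ _ _ _ ()) , (λ _ ()) , (λ _ _ ())
theorem3p1 (suc ℓ) = 3 + 6 * q , size≤ , λ c → path⇒monoCopy (2 + 6 * q) c ℓ (shorten c (Staircases.long-path (2 + 6 * q) c q refl))
  where
  -- With `t = suc ℓ` this gives `2q ≤ t ≤ 2q + 1`: the first keeps `6q + 3` within `3t + 3`, the
  -- second provides `t` cells, one more than the path has edges, to spare for parity.
  q = ⌊ suc ℓ /2⌋
  2q≤ : 2 * q ≤ suc ℓ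
  2q≤ = subst (2 * q ≤_) (⌊n/2⌋+⌈n/2⌉≡n (suc ℓ)) (≤-trans (≤-reflexive (cong (q +_) (+-identityʳ q))) (+-monoʳ-≤ q (⌊n/2⌋≤⌈n/2⌉ (suc ℓ))))
  ≤1+2q : suc ℓ ≤ suc (2 * q)
  ≤1+2q = subst (_≤ suc (2 * q)) (⌊n/2⌋+⌈n/2⌉≡n (suc ℓ)) (≤-trans (+-monoʳ-≤ q (s≤s (⌊n/2⌋-mono (n≤1+n ℓ)))) (≤-reflexive (arith q)))
    where
    arith : ∀ q → q + suc q ≡ suc (2 * q)
    arith = solve-∀
  size≤ : 3 + 6 * q ≤ 3 * suc ℓ + 3
  size≤ = ≤-trans (≤-reflexive (arith q)) (+-monoˡ-≤ 3 (*-monoʳ-≤ 3 2q≤))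
    where
    arith : ∀ q → 3 + 6 * q ≡ 3 * (2 * q) + 3
    arith = solve-∀
  shorten : ∀ c → Staircases.LongPath (2 + 6 * q) c (suc (2 * q)) → Staircases.LongPath (2 + 6 * q) c (suc ℓ)
  shorten c (k , s , v , b , p) = k , s , v , b , Staircases.truncate (2 + 6 * q) c ≤1+2q p
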